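{- Let $G$ be a super-$\lambda'$ graph. If $G$ is not $\lambda''$-connected, then $\rho'(G)=\delta(G)-1$, where $\delta(G)$ is the minimum vertex-degree of $G$.
   Context: All graphs are finite and simple. For a connected graph $G=(V,E)$ and an integer $h\geqslant 0$, a set $F\subseteq E(G)$ is an $h$-extra edge-cut if $G-F$ is disconnected and every component of $G-F$ has more than $h$ vertices. If such a set exists, $\lambda^{(h)}(G)$ is the minimum cardinality of an $h$-extra edge-cut, and $G$ is called $\lambda^{(h)}$-connected; otherwise $G$ is not $\lambda^{(h)}$-connected. A $\lambda^{(h)}$-cut is an $h$-extra edge-cut of cardinality $\lambda^{(h)}(G)$. Write $\lambda'=\lambda^{(1)}$ and $\lambda''=\lambda^{(2)}$. For an edge $xy$, its edge-degree is $d_G(x)+d_G(y)-2$, and $\xi(G)$ is the minimum edge-degree of $G$. A $\lambda'$-connected graph $G$ is super-$\lambda'$ if $\lambda'(G)=\xi(G)$ and, for every $\lambda'$-cut $F$ of $G$, some component of $G-F$ has exactly $2$ vertices. A disconnected graph is not super-$\lambda'$. For a super-$\lambda'$ graph $G$, the persistence $\rho'(G)$ is the maximum integer $m$ such that $G-F$ is still super-$\lambda'$ for every $F\subseteq E(G)$ with $|F|\leqslant m$. -}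

module Defs where

open import Data.Bool.Base using (Bool; T; _∧_; not)
open import Data.Bool.Properties using (T-∧)
open import Data.Fin.Base using (Fin)
open import Data.Fin.Properties using (_<?_)
open import Data.Fin.Subset using (Subset; _∈_; ∣_∣)
open import Data.Integer.Base as ℤ using (ℤ; +_)
open import Data.Nat.Base using (ℕ; _+_; _∸_; _≤_; _<_)
open import Data.Nat.Properties using (+-0-commutativeMonoid)
open import Data.Product.Base using (∃-syntax; _×_; _,_; proj₁)
open import Data.Vec.Base using (tabulate)
open import Function.Bundles using (_⇔_; module Equivalence)
open import Level using (0ℓ)
open import Relation.Binary.Construct.Closure.ReflexiveTransitive using (Star)
open import Relation.Binary.Core using (Rel; _⇒_)
open import Relation.Binary.Definitions using (Symmetric; Irreflexive)
open import Relation.Binary.PropositionalEquality.Core using (_≡_)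
open import Relation.Nullary.Decidable.Core using (does)
open import Relation.Nullary.Negation.Core using (¬_)
open import Algebra.Properties.CommutativeMonoid.Sum +-0-commutativeMonoid
  using (sum-syntax)

IsMinimum : (ℕ → Set) → ℕ → Set
IsMinimum P k = P k × (∀ j → P j → k ≤ j)

IsMaximum : (ℤ → Set) → ℤ → Set
IsMaximum P m = P m × (∀ j → P j → j ℤ.≤ m)

-- A simple graph on the vertex set Fin n.  Since such a graph is determined
-- by its edges, this type also serves as the type of sets of edges.
record Graph (n : ℕ) : Set where
  field
    adj : Fin n → Fin n → Bool

  _~_ : Rel (Fin n) 0ℓ
  i ~ j = T (adj i j)

  field
    symmetric   : Symmetric _~_
    irreflexive : Irreflexive _≡_ _~_

EdgeSet : ℕ → Set
EdgeSet = Graph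

module _ {n : ℕ} where

  open Graph

  infix  4 _⊆_
  infixl 6 _∖_

  _⊆_ : EdgeSet n → Graph n → Set
  F ⊆ G = _~_ F ⇒ _~_ G

  -- Each edge {i , j} is counted once, with i < j.
  size : EdgeSet n → ℕ
  size F = ∑[ i < n ] ∣ tabulate (λ j → does (i <? j) ∧ adj F i j) ∣

  _∖_ : Graph n → EdgeSet n → Graph n
  (G ∖ F) .adj i j = adj G i j ∧ not (adj F i j)
  (G ∖ F) .symmetric {i} {j} p =
    let g , f = Equivalence.to T-∧ p
    in Equivalence.from T-∧ (symmetric G g , swap-not (adj F i j) (adj F j i) (symmetric F) f)
    where
    swap-not : ∀ b c → (T c → T b) → T (not b) → T (not c)
    swap-not Bool.false Bool.false _ _ = _
    swap-not Bool.false Bool.true  h _ = h _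
  (G ∖ F) .irreflexive eq p = irreflexive G eq (proj₁ (Equivalence.to T-∧ p))

  degree : Graph n → Fin n → ℕ
  degree G v = ∣ tabulate (adj G v) ∣

  -- The truncated subtraction is exact when x and y are adjacent.
  edgeDegree : Graph n → Fin n → Fin n → ℕ
  edgeDegree G x y = degree G x + degree G y ∸ 2

  IsMinDegree : Graph n → ℕ → Set
  IsMinDegree G = IsMinimum (λ d → ∃[ v ] degree G v ≡ d)

  IsMinEdgeDegree : Graph n → ℕ → Set
  IsMinEdgeDegree G =
    IsMinimum (λ d → ∃[ x ] ∃[ y ] _~_ G x y × edgeDegree G x y ≡ d)

  Reachable : Graph n → Rel (Fin n) 0ℓ
  Reachable G = Star (_~_ G)

  -- The null graph counts as connected here; having no extra edge-cut, it is
  -- not super-λ′ under either convention.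
  Connected : Graph n → Set
  Connected G = ∀ u v → Reachable G u v

  IsComponent : Graph n → Subset n → Set
  IsComponent G C = ∃[ v ] (∀ u → u ∈ C ⇔ Reachable G v u)

  IsExtraEdgeCut : ℕ → Graph n → EdgeSet n → Set
  IsExtraEdgeCut h G F =
    F ⊆ G × ¬ Connected (G ∖ F) × (∀ C → IsComponent (G ∖ F) C → h < ∣ C ∣)

  λ-Connected : ℕ → Graph n → Set
  λ-Connected h G = Connected G × (∃[ F ] IsExtraEdgeCut h G F)

  -- Is-λ h G k says that λ⁽ʰ⁾(G) is defined and equal to k.
  Is-λ : ℕ → Graph n → ℕ → Set
  Is-λ h G k =
    Connected G × IsMinimum (λ j → ∃[ F ] IsExtraEdgeCut h G F × size F ≡ j) k

  Is-λ-Cut : ℕ → Graph n → EdgeSet n → Set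
  Is-λ-Cut h G F = IsExtraEdgeCut h G F × Is-λ h G (size F)

  Super-λ′ : Graph n → Set
  Super-λ′ G =
    λ-Connected 1 G ×
    (∃[ k ] Is-λ 1 G k × IsMinEdgeDegree G k) ×
    (∀ F → Is-λ-Cut 1 G F → ∃[ C ] IsComponent (G ∖ F) C × ∣ C ∣ ≡ 2)

  -- The maximum is taken over all integers, so that the value δ(G) - 1 needs
  -- no truncated subtraction.
  IsPersistence : Graph n → ℤ → Set
  IsPersistence G =
    IsMaximum (λ m → ∀ F → F ⊆ G → + size F ℤ.≤ m → Super-λ′ (G ∖ F))

{-# OPTIONS --safe #-}
-- Without a 2-extra edge-cut, every 1-extra edge-cut leaves a component with
-- exactly two vertices x, y, hence contains the boundary of {x , y} and has at
-- least ξ edges.  Conversely, in a connected graph on at least four vertices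
-- that is not a star, the boundary of an edge of minimum edge-degree is a
-- 1-extra edge-cut: an isolated vertex outside that edge would produce either
-- a three-vertex component or a 1-extra edge-cut with fewer than ξ edges.  So
-- a connected graph that is not λ″-connected is super-λ′ as soon as it has at
-- least four vertices and is not a star.
--
-- Having no 2-extra edge-cut is inherited by connected spanning subgraphs, so
-- it remains to see that removing fewer than δ edges leaves G connected and
-- not a star.  If G - F were disconnected, F would be a 1-extra edge-cut (no
-- vertex can be isolated), so 2δ - 2 ≤ ξ ≤ |F| < δ and F would be empty; stars
-- are excluded by counting degrees in F.  Removing the δ edges at a vertex of
-- minimum degree disconnects G, so δ - 1 is optimal.
module Submission where

open import Data.Bool.Base using (Bool; true; false; T; _∧_; _xor_; not; if_then_else_)
open import Data.Bool.Properties using (T-∧; T-≡; T?; ⇔→≡)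
open import Data.Empty using (⊥)
open import Data.Fin.Base using (Fin; zero; suc)
open import Data.Fin.Properties using (_≟_; _<?_; any?; all?; ¬∀⟶∃¬; <-cmp)
open import Data.Fin.Subset using (Subset; ∣_∣; _∈_)
open import Data.Fin.Subset.Properties using (p⊆q⇒∣p∣≤∣q∣)
open import Data.Integer.Base using (+_; _-_)
import Data.Integer as ℤ
import Data.Integer.Properties as ℤ
open import Data.List.Base using (List; []; _∷_; map; length; allFin)
open import Data.List.Membership.DecPropositional using ()
import Data.List.Membership.Propositional as Mem
open import Data.List.Membership.Propositional.Properties using (∈-allFin)
open import Data.List.Relation.Unary.All as All using (All; []; _∷_)
open import Data.List.Relation.Unary.All.Properties using (All¬⇒¬Any)
open import Data.List.Relation.Unary.AllPairs using ([]; _∷_)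
open import Data.List.Relation.Unary.Any using (here; there)
open import Data.List.Relation.Unary.Unique.Propositional using (Unique)
open import Data.Nat.Base using (ℕ; zero; suc; _+_; _∸_; _≤_; _<_; z≤n; s≤s; ⌊_/2⌋)
open import Data.Nat.ListAction using (sum)
open import Data.Nat.Properties hiding (_≟_; _<?_; <-cmp)
open import Data.Nat.Properties using () renaming (_≟_ to _≟ℕ_)
open import Data.Product.Base using (∃-syntax; _×_; _,_; proj₁; proj₂)
open import Data.Sum.Base using (_⊎_; inj₁; inj₂)
open import Data.Unit.Base using (tt)
open import Data.Vec.Base using (lookup; tabulate)
open import Data.Vec.Properties using (tabulate∘lookup; lookup∘tabulate; []=⇒lookup; lookup⇒[]=)
open import Function.Base using (_∘_)
open import Function.Bundles using (mk⇔; module Equivalence)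
open import Relation.Binary.Construct.Closure.ReflexiveTransitive using (ε; _◅_; _◅◅_)
open import Relation.Binary.Definitions using (tri<; tri≈; tri>)
open import Relation.Binary.PropositionalEquality
open import Relation.Nullary.Decidable using (Dec; yes; no; does; dec-true; dec-false; ¬?; _×-dec_; _⊎-dec_; map′; decidable-stable)
open import Relation.Nullary.Negation using (¬_; contradiction)
open import Relation.Unary using (Decidable)
open import Algebra.Properties.CommutativeMonoid.Sum +-0-commutativeMonoid using (sum-syntax; sum-cong-≗; ∑-distrib-+; ∑-comm)
open import Defs
open Graph

private variable n : ℕ

-- Decidable membership and 0/1 indicators.

_∈?_ : (i : Fin n) (xs : List (Fin n)) → Dec (i Mem.∈ xs)
_∈?_ = Data.List.Membership.DecPropositional._∈?_ _≟_

does⁺ : {P : Set} (P? : Dec P) → P → T (does P?)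
does⁺ (yes _) _ = tt
does⁺ (no ¬p) p = ¬p p

does⁻ : {P : Set} (P? : Dec P) → T (does P?) → P
does⁻ (yes p) _ = p

𝟙 : Bool → ℕ
𝟙 b = if b then 1 else 0

𝟙-≤ : ∀ {a b} → (T a → T b) → 𝟙 a ≤ 𝟙 b
𝟙-≤ {false}        _ = z≤n
𝟙-≤ {true} {true}  _ = s≤s z≤n
𝟙-≤ {true} {false} h = contradiction (h tt) λ ()

𝟙-true : ∀ {a} → T a → 𝟙 a ≡ 1
𝟙-true {true} _ = refl

𝟙-false : ∀ {a} → ¬ T a → 𝟙 a ≡ 0
𝟙-false {false} _ = refl
𝟙-false {true}  h = contradiction tt h

-- Finite sums

∑-mono : {f g : Fin n → ℕ} → (∀ i → f i ≤ g i) → ∑[ i < n ] f i ≤ ∑[ i < n ] g i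
∑-mono {zero}  _ = z≤n
∑-mono {suc n} h = +-mono-≤ (h zero) (∑-mono (h ∘ suc))

∑-zero : {f : Fin n → ℕ} → (∀ i → f i ≡ 0) → ∑[ i < n ] f i ≡ 0
∑-zero {zero}  _ = refl
∑-zero {suc n} h = cong₂ _+_ (h zero) (∑-zero (h ∘ suc))

off : List (Fin n) → (Fin n → ℕ) → Fin n → ℕ
off xs g j = if does (j ∈? xs) then 0 else g j

off-∉ : ∀ {xs} (g : Fin n → ℕ) {j} → ¬ j Mem.∈ xs → off xs g j ≡ g j
off-∉ {xs = xs} g {j} p rewrite dec-false (j ∈? xs) p = refl

off-elim : ∀ xs (g : Fin n → ℕ) (P : ℕ → Set) j → (j Mem.∈ xs → P 0) → (¬ j Mem.∈ xs → P (g j)) → P (off xs g j)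
off-elim xs g P j p q with j ∈? xs
... | yes j∈ = p j∈
... | no  j∉ = q j∉

∑-pick : (g : Fin n → ℕ) (x : Fin n) →
         ∑[ j < n ] g j ≡ g x + ∑[ j < n ] (if does (j ≟ x) then 0 else g j)
∑-pick {suc n} g zero    = refl
∑-pick {suc n} g (suc x) = begin
  g zero + s              ≡⟨ cong (_+_ (g zero)) (∑-pick (g ∘ suc) x) ⟩
  g zero + (g (suc x) + r) ≡⟨ +-assoc (g zero) (g (suc x)) r ⟨
  g zero + g (suc x) + r   ≡⟨ cong (_+ r) (+-comm (g zero) (g (suc x))) ⟩
  g (suc x) + g zero + r   ≡⟨ +-assoc (g (suc x)) (g zero) r ⟩
  g (suc x) + (g zero + r) ∎
  where
  open ≡-Reasoning
  s = ∑[ j < n ] g (suc j)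
  r = ∑[ j < n ] (if does (j ≟ x) then 0 else g (suc j))

-- Distinctness keeps a term from being taken out twice: when `x` joins the list, its term is still
-- present in the remainder for `xs`.
∑-split : (g : Fin n → ℕ) {xs : List (Fin n)} → Unique xs →
          ∑[ j < n ] g j ≡ sum (map g xs) + ∑[ j < n ] off xs g j
∑-split g [] = refl
∑-split {n} g {x ∷ xs} (x∉xs ∷ u) = begin
  ∑[ j < n ] g j                               ≡⟨ ∑-split g u ⟩
  l + ∑[ j < n ] off xs g j                    ≡⟨ cong (_+_ l) (∑-pick (off xs g) x) ⟩
  l + (off xs g x + r)                         ≡⟨ cong₂ (λ a b → l + (a + b)) (off-∉ g (All¬⇒¬Any x∉xs)) (sum-cong-≗ merge) ⟩
  l + (g x + ∑[ j < n ] off (x ∷ xs) g j)      ≡⟨ +-assoc l (g x) _ ⟨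
  l + g x + ∑[ j < n ] off (x ∷ xs) g j        ≡⟨ cong (_+ ∑[ j < n ] off (x ∷ xs) g j) (+-comm l (g x)) ⟩
  g x + l + ∑[ j < n ] off (x ∷ xs) g j        ∎
  where
  open ≡-Reasoning
  l = sum (map g xs)
  r = ∑[ j < n ] (if does (j ≟ x) then 0 else off xs g j)
  merge : ∀ j → (if does (j ≟ x) then 0 else off xs g j) ≡ off (x ∷ xs) g j
  merge j with does (j ≟ x)
  ... | true  = refl
  ... | false = refl

∑-≥ : (g : Fin n → ℕ) {xs : List (Fin n)} → Unique xs → sum (map g xs) ≤ ∑[ j < n ] g j
∑-≥ g u = ≤-trans (m≤m+n _ _) (≤-reflexive (sym (∑-split g u)))

∑-support : (g : Fin n → ℕ) {xs : List (Fin n)} → Unique xs → (∀ j → ¬ j Mem.∈ xs → g j ≡ 0) →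
            ∑[ j < n ] g j ≡ sum (map g xs)
∑-support g {xs} u z = trans (∑-split g u) (trans (cong (_+_ _) (∑-zero vanish)) (+-identityʳ _))
  where
  vanish : ∀ j → off xs g j ≡ 0
  vanish j = off-elim xs g (_≡ 0) j (λ _ → refl) (z j)

count-≥ : (f : Fin n → Bool) {xs : List (Fin n)} → Unique xs → All (T ∘ f) xs →
          length xs ≤ ∑[ j < n ] 𝟙 (f j)
count-≥ f {xs} u a = ≤-trans (≤-reflexive (sym (ones a))) (∑-≥ (𝟙 ∘ f) u)
  where
  ones : ∀ {ys} → All (T ∘ f) ys → sum (map (𝟙 ∘ f) ys) ≡ length ys
  ones []      = refl
  ones (t ∷ a) = cong₂ _+_ (𝟙-true t) (ones a)

count-≤ : (f : Fin n → Bool) {xs : List (Fin n)} → Unique xs → (∀ j → T (f j) → j Mem.∈ xs) →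
          ∑[ j < n ] 𝟙 (f j) ≤ length xs
count-≤ f {xs} u h = ≤-trans (≤-reflexive (∑-support (𝟙 ∘ f) u λ j j∉ → 𝟙-false (j∉ ∘ h j))) (ones xs)
  where
  ones : ∀ ys → sum (map (𝟙 ∘ f) ys) ≤ length ys
  ones []       = z≤n
  ones (y ∷ ys) with f y
  ... | true  = s≤s (ones ys)
  ... | false = m≤n⇒m≤1+n (ones ys)

∑-one : ∀ n → ∑[ j < n ] 1 ≡ n
∑-one zero    = refl
∑-one (suc n) = cong suc (∑-one n)

fresh : {xs : List (Fin n)} → Unique xs → length xs < n → ∃[ z ] ¬ z Mem.∈ xs
fresh {n} {xs} u l = ¬∀⟶∃¬ n (Mem._∈ xs) (_∈? xs) λ h →
  <⇒≱ l (subst (_≤ length xs) (∑-one n) (count-≤ (λ _ → true) u λ j _ → h j))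

unique₁ : {x : Fin n} → Unique (x ∷ [])
unique₁ = [] ∷ []

unique₂ : {x y : Fin n} → x ≢ y → Unique (x ∷ y ∷ [])
unique₂ p = (p ∷ []) ∷ unique₁

unique₃ : {x y z : Fin n} → x ≢ y → x ≢ z → y ≢ z → Unique (x ∷ y ∷ z ∷ [])
unique₃ p q r = (p ∷ q ∷ []) ∷ unique₂ r

∣tabulate∣ : (f : Fin n → Bool) → ∣ tabulate f ∣ ≡ ∑[ j < n ] 𝟙 (f j)
∣tabulate∣ {zero}  f = refl
∣tabulate∣ {suc n} f with f zero
... | true  = cong suc (∣tabulate∣ (f ∘ suc))
... | false = ∣tabulate∣ (f ∘ suc)

∣_∣-∑ : (C : Subset n) → ∣ C ∣ ≡ ∑[ j < n ] 𝟙 (lookup C j)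
∣ C ∣-∑ = trans (cong ∣_∣ (sym (tabulate∘lookup C))) (∣tabulate∣ (lookup C))

∈⇒T : {C : Subset n} {j : Fin n} → j ∈ C → T (lookup C j)
∈⇒T p = Equivalence.from T-≡ ([]=⇒lookup p)

T⇒∈ : {C : Subset n} {j : Fin n} → T (lookup C j) → j ∈ C
T⇒∈ {C = C} {j} t = lookup⇒[]= j C (Equivalence.to T-≡ t)

∣∣-≥ : {C : Subset n} {xs : List (Fin n)} → Unique xs → All (_∈ C) xs → length xs ≤ ∣ C ∣
∣∣-≥ {C = C} u a = ≤-trans (count-≥ (lookup C) u (All.map ∈⇒T a)) (≤-reflexive (sym ∣ C ∣-∑))

-- Sizes of edge sets and boundaries

~-sym : (G : Graph n) (i j : Fin n) → adj G i j ≡ adj G j i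
~-sym G i j = ⇔→≡ (mk⇔ (flip i j) (flip j i))
  where
  flip : ∀ i j → adj G i j ≡ true → adj G j i ≡ true
  flip i j e = Equivalence.to T-≡ (symmetric G {i} {j} (Equivalence.from T-≡ e))

~⇒≢ : (G : Graph n) {i j : Fin n} → _~_ G i j → i ≢ j
~⇒≢ G p e = irreflexive G e p

-- Double counting: exchanging the order of summation shows that `g` and its transpose have the same
-- total.
∑∑-oriented : {f g : Fin n → Fin n → ℕ} → (∀ i j → f i j ≡ g i j + g j i) →
              ∑[ i < n ] ∑[ j < n ] f i j ≡ ∑[ i < n ] ∑[ j < n ] g i j + ∑[ i < n ] ∑[ j < n ] g i j
∑∑-oriented {n} {f} {g} h = begin
  ∑[ i < n ] ∑[ j < n ] f i j                                ≡⟨ sum-cong-≗ (λ i → sum-cong-≗ (h i)) ⟩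
  ∑[ i < n ] ∑[ j < n ] (g i j + g j i)                      ≡⟨ sum-cong-≗ (λ i → ∑-distrib-+ (g i) (λ j → g j i)) ⟩
  ∑[ i < n ] (∑[ j < n ] g i j + ∑[ j < n ] g j i)           ≡⟨ ∑-distrib-+ (λ i → ∑[ j < n ] g i j) (λ i → ∑[ j < n ] g j i) ⟩
  s + ∑[ i < n ] ∑[ j < n ] g j i                            ≡⟨ cong (_+_ s) (∑-comm (λ i j → g j i)) ⟩
  s + s                                                      ∎
  where
  open ≡-Reasoning
  s = ∑[ i < n ] ∑[ j < n ] g i j

degree-∑ : (G : Graph n) (v : Fin n) → degree G v ≡ ∑[ j < n ] 𝟙 (adj G v j)
degree-∑ G v = ∣tabulate∣ (adj G v)

size-∑ : (F : EdgeSet n) → size F ≡ ∑[ i < n ] ∑[ j < n ] 𝟙 (does (i <? j) ∧ adj F i j)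
size-∑ F = sum-cong-≗ λ i → ∣tabulate∣ (λ j → does (i <? j) ∧ adj F i j)

-- An edge is seen from both of its ends; the condition `i < j` orients it, and the diagonal
-- vanishes by irreflexivity.
handshake : (F : EdgeSet n) → ∑[ i < n ] degree F i ≡ size F + size F
handshake {n} F = begin
  ∑[ i < n ] degree F i                ≡⟨ sum-cong-≗ (degree-∑ F) ⟩
  ∑[ i < n ] ∑[ j < n ] 𝟙 (adj F i j)  ≡⟨ ∑∑-oriented split ⟩
  s + s                                ≡⟨ cong₂ _+_ (size-∑ F) (size-∑ F) ⟨
  size F + size F                      ∎
  where
  open ≡-Reasoning
  s = ∑[ i < n ] ∑[ j < n ] 𝟙 (does (i <? j) ∧ adj F i j)
  split : ∀ i j → 𝟙 (adj F i j) ≡ 𝟙 (does (i <? j) ∧ adj F i j) + 𝟙 (does (j <? i) ∧ adj F j i)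
  split i j with <-cmp i j
  ... | tri< i<j _ j≮i rewrite dec-true (i <? j) i<j | dec-false (j <? i) j≮i = sym (+-identityʳ _)
  ... | tri≈ i≮j e j≮i rewrite dec-false (i <? j) i≮j | dec-false (j <? i) j≮i = 𝟙-false (irreflexive F e)
  ... | tri> i≮j _ j<i rewrite dec-false (i <? j) i≮j | dec-true (j <? i) j<i = cong 𝟙 (~-sym F i j)

size-mono : (F F′ : EdgeSet n) → F ⊆ F′ → size F ≤ size F′
size-mono F F′ F⊆F′ = subst₂ _≤_ (sym (size-∑ F)) (sym (size-∑ F′))
  (∑-mono λ i → ∑-mono λ j → 𝟙-≤ (λ t →
    let p , q = Equivalence.to T-∧ t in Equivalence.from T-∧ (p , F⊆F′ {i} {j} q)))

-- The edge cut between `C` and its complement. A Boolean function serves for `C` because both lists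
-- and reachability tests give one.
∂ : Graph n → (Fin n → Bool) → EdgeSet n
∂ G C .adj i j = adj G i j ∧ (C i xor C j)
∂ G C .symmetric {i} {j} p =
  let g , c = Equivalence.to T-∧ p
  in Equivalence.from T-∧ (symmetric G {i} {j} g , xor-sym (C i) (C j) c)
  where
  xor-sym : ∀ a b → T (a xor b) → T (b xor a)
  xor-sym true  false _ = tt
  xor-sym false true  _ = tt
∂ G C .irreflexive e p = irreflexive G e (proj₁ (Equivalence.to T-∧ p))

-- Counts the boundary edges at their end inside `C`; the value is 0 at vertices outside.
out : Graph n → (Fin n → Bool) → Fin n → ℕ
out {n} G C i = ∑[ j < n ] 𝟙 (C i ∧ not (C j) ∧ adj G i j)

double-injective : ∀ {m k} → m + m ≡ k + k → m ≡ k
double-injective {m} {k} e = trans (n≡⌊n+n/2⌋ m) (trans (cong ⌊_/2⌋ e) (sym (n≡⌊n+n/2⌋ k)))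

-- Each boundary edge has exactly one end in `C`, so counting at that end gives half of the degree
-- sum of `∂ G C`.
size-∂ : (G : Graph n) (C : Fin n → Bool) → size (∂ G C) ≡ ∑[ i < n ] out G C i
size-∂ {n} G C = double-injective (begin
  size (∂ G C) + size (∂ G C)                ≡⟨ handshake (∂ G C) ⟨
  ∑[ i < n ] degree (∂ G C) i                ≡⟨ sum-cong-≗ (degree-∑ (∂ G C)) ⟩
  ∑[ i < n ] ∑[ j < n ] 𝟙 (adj (∂ G C) i j)  ≡⟨ ∑∑-oriented orient ⟩
  s + s                                      ∎)
  where
  open ≡-Reasoning
  s = ∑[ i < n ] out G C i
  cases : ∀ a b g → 𝟙 (g ∧ (a xor b)) ≡ 𝟙 (a ∧ not b ∧ g) + 𝟙 (b ∧ not a ∧ g)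
  cases true  true  true  = refl
  cases true  true  false = refl
  cases true  false true  = refl
  cases true  false false = refl
  cases false true  true  = refl
  cases false true  false = refl
  cases false false true  = refl
  cases false false false = refl
  orient : ∀ i j → 𝟙 (adj (∂ G C) i j) ≡ 𝟙 (C i ∧ not (C j) ∧ adj G i j) + 𝟙 (C j ∧ not (C i) ∧ adj G j i)
  orient i j rewrite ~-sym G j i = cases (C i) (C j) (adj G i j)

⟦_⟧ : List (Fin n) → Fin n → Bool
⟦ xs ⟧ i = does (i ∈? xs)

size-∂-list : (G : Graph n) {xs : List (Fin n)} → Unique xs →
              size (∂ G ⟦ xs ⟧) ≡ sum (map (out G ⟦ xs ⟧) xs)
size-∂-list {n} G {xs} u = trans (size-∂ G ⟦ xs ⟧) (∑-support (out G ⟦ xs ⟧) u vanish)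
  where
  vanish : ∀ j → ¬ j Mem.∈ xs → out G ⟦ xs ⟧ j ≡ 0
  vanish j j∉ rewrite dec-false (j ∈? xs) j∉ = ∑-zero {n} (λ _ → refl)

degree-split : (G : Graph n) {xs : List (Fin n)} {x : Fin n} → Unique xs → x Mem.∈ xs →
               degree G x ≡ sum (map (λ y → 𝟙 (adj G x y)) xs) + out G ⟦ xs ⟧ x
degree-split {n} G {xs} {x} u x∈ = trans (degree-∑ G x)
  (trans (∑-split (λ y → 𝟙 (adj G x y)) u) (cong (_+_ (sum (map (λ y → 𝟙 (adj G x y)) xs))) (sum-cong-≗ same)))
  where
  same : ∀ j → off xs (λ y → 𝟙 (adj G x y)) j ≡ 𝟙 (⟦ xs ⟧ x ∧ not (⟦ xs ⟧ j) ∧ adj G x j)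
  same j rewrite dec-true (x ∈? xs) x∈ with j ∈? xs
  ... | yes _ = refl
  ... | no  _ = refl

size-star : (G : Graph n) (v : Fin n) → size (∂ G ⟦ v ∷ [] ⟧) ≡ degree G v
size-star G v = begin
  size (∂ G ⟦ v ∷ [] ⟧)                       ≡⟨ size-∂-list G unique₁ ⟩
  o + 0                                       ≡⟨ +-identityʳ o ⟩
  o                                           ≡⟨ cong (λ a → a + 0 + o) (𝟙-false (irreflexive G refl)) ⟨
  𝟙 (adj G v v) + 0 + o                       ≡⟨ degree-split G unique₁ (here refl) ⟨
  degree G v                                  ∎
  where
  open ≡-Reasoning
  o = out G ⟦ v ∷ [] ⟧ v

-- Each of `x` and `y` has exactly one neighbour inside the pair, namely the other, which accounts
-- for the 2 subtracted.
size-edge : (G : Graph n) {x y : Fin n} → _~_ G x y → size (∂ G ⟦ x ∷ y ∷ [] ⟧) ≡ edgeDegree G x y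
size-edge G {x} {y} p = sym (begin
  degree G x + degree G y ∸ 2    ≡⟨ cong₂ (λ a b → a + b ∸ 2) dx dy ⟩
  suc ox + suc oy ∸ 2            ≡⟨ cong (_∸ 1) (+-suc ox oy) ⟩
  ox + oy                        ≡⟨ cong (_+_ ox) (+-identityʳ oy) ⟨
  ox + (oy + 0)                  ≡⟨ size-∂-list G u ⟨
  size (∂ G ⟦ x ∷ y ∷ [] ⟧)      ∎)
  where
  open ≡-Reasoning
  u = unique₂ (~⇒≢ G p)
  ox = out G ⟦ x ∷ y ∷ [] ⟧ x
  oy = out G ⟦ x ∷ y ∷ [] ⟧ y
  dx : degree G x ≡ suc ox
  dx = trans (degree-split G u (here refl))
    (cong₂ (λ a b → a + (b + 0) + ox) (𝟙-false (irreflexive G refl)) (𝟙-true p))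
  dy : degree G y ≡ suc oy
  dy = trans (degree-split G u (there (here refl)))
    (cong₂ (λ a b → a + (b + 0) + oy) (𝟙-true (symmetric G {x} {y} p)) (𝟙-false (irreflexive G refl)))

-- Reachability

-- Floyd–Warshall: u and v are joined by a walk whose inner vertices lie in the list.
Via : Graph n → List (Fin n) → Fin n → Fin n → Set
Via G []       u v = u ≡ v ⊎ _~_ G u v
Via G (k ∷ ks) u v = Via G ks u v ⊎ (Via G ks u k × Via G ks k v)

via? : (G : Graph n) (ks : List (Fin n)) (u v : Fin n) → Dec (Via G ks u v)
via? G []       u v = (u ≟ v) ⊎-dec T? (adj G u v)
via? G (k ∷ ks) u v = via? G ks u v ⊎-dec (via? G ks u k ×-dec via? G ks k v)

via⇒reachable : (G : Graph n) (ks : List (Fin n)) {u v : Fin n} → Via G ks u v → Reachable G u v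
via⇒reachable G []       (inj₁ refl)    = ε
via⇒reachable G []       (inj₂ e)       = e ◅ ε
via⇒reachable G (k ∷ ks) (inj₁ p)       = via⇒reachable G ks p
via⇒reachable G (k ∷ ks) (inj₂ (p , q)) = via⇒reachable G ks p ◅◅ via⇒reachable G ks q

via-step : (G : Graph n) (ks : List (Fin n)) {u v : Fin n} → u ≡ v ⊎ _~_ G u v → Via G ks u v
via-step G []       p = p
via-step G (k ∷ ks) p = inj₁ (via-step G ks p)

-- A walk ending at `k` can stop at its first visit there, so allowing `k` as an inner vertex gains
-- nothing.
via-to : (G : Graph n) (k : Fin n) (ks : List (Fin n)) {u : Fin n} → Via G (k ∷ ks) u k → Via G ks u k
via-to G k ks (inj₁ p)       = p
via-to G k ks (inj₂ (p , _)) = p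

via-from : (G : Graph n) (k : Fin n) (ks : List (Fin n)) {v : Fin n} → Via G (k ∷ ks) k v → Via G ks k v
via-from G k ks (inj₁ p)       = p
via-from G k ks (inj₂ (_ , p)) = p

-- Closure under joining at an allowed vertex, which makes the recursion complete for reachability.
via-trans : (G : Graph n) (ks : List (Fin n)) {u m v : Fin n} → m Mem.∈ ks →
            Via G ks u m → Via G ks m v → Via G ks u v
via-trans G (k ∷ ks) (here refl) p q = inj₂ (via-to G k ks p , via-from G k ks q)
via-trans G (k ∷ ks) (there m∈) (inj₁ p)       (inj₁ q)       = inj₁ (via-trans G ks m∈ p q)
via-trans G (k ∷ ks) (there m∈) (inj₁ p)       (inj₂ (q , r)) = inj₂ (via-trans G ks m∈ p q , r)
via-trans G (k ∷ ks) (there m∈) (inj₂ (p , q)) (inj₁ r)       = inj₂ (p , via-trans G ks m∈ q r)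
-- Both walks pass through `k`; the detour between the two visits, which contains `m`, is dropped.
via-trans G (k ∷ ks) (there m∈) (inj₂ (p , _)) (inj₂ (_ , r)) = inj₂ (p , r)

reachable⇒via : (G : Graph n) {u v : Fin n} → Reachable G u v → Via G (allFin n) u v
reachable⇒via {n} G ε       = via-step G (allFin n) (inj₁ refl)
reachable⇒via {n} G (_◅_ {j = m} e p) =
  via-trans G (allFin n) (∈-allFin m) (via-step G (allFin n) (inj₂ e)) (reachable⇒via G p)

abstract
  reachable? : (G : Graph n) (u v : Fin n) → Dec (Reachable G u v)
  reachable? {n} G u v = map′ (via⇒reachable G (allFin n)) (reachable⇒via G) (via? G (allFin n) u v)

connected? : (G : Graph n) → Dec (Connected G)
connected? G = all? λ u → all? λ v → reachable? G u v

disconnected : (G : Graph n) → ¬ Connected G → ∃[ u ] ∃[ v ] ¬ Reachable G u v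
disconnected {n} G ¬c with ¬∀⟶∃¬ n _ (λ u → all? λ v → reachable? G u v) ¬c
... | u , ¬r = u , ¬∀⟶∃¬ n _ (reachable? G u) ¬r

reachable-mono : (G H : Graph n) → G ⊆ H → ∀ {u v} → Reachable G u v → Reachable H u v
reachable-mono G H G⊆H ε = ε
reachable-mono G H G⊆H (_◅_ {i} {j} e p) = G⊆H {i} {j} e ◅ reachable-mono G H G⊆H p

reachable-sym : (G : Graph n) → ∀ {u v} → Reachable G u v → Reachable G v u
reachable-sym G ε = ε
reachable-sym G (_◅_ {i} {j} e p) = reachable-sym G p ◅◅ (symmetric G {i} {j} e ◅ ε)

reachable-preserves : (G : Graph n) (P : Fin n → Set) → (∀ {i j} → P i → _~_ G i j → P j) →
                      ∀ {u v} → Reachable G u v → P u → P v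
reachable-preserves G P h ε       pu = pu
reachable-preserves G P h (_◅_ {i} {j} e p) pu = reachable-preserves G P h p (h {i} {j} pu e)

first-step : (G : Graph n) → ∀ {u v} → u ≢ v → Reachable G u v → ∃[ w ] _~_ G u w
first-step G u≢v ε       = contradiction refl u≢v
first-step G u≢v (e ◅ _) = _ , e

connected-neighbour : (G : Graph n) → Connected G → 2 ≤ n → ∀ u → ∃[ w ] _~_ G u w
connected-neighbour G c 2≤n u with fresh {xs = u ∷ []} unique₁ 2≤n
... | v , v∉ = first-step G (λ e → v∉ (here (sym e))) (c u v)

-- Edge deletion and boundaries.

T-not⁻ : ∀ b → T (not b) → ¬ T b
T-not⁻ false _ ()

∖⁺ : (G F : Graph n) {i j : Fin n} → _~_ G i j → ¬ _~_ F i j → _~_ (G ∖ F) i j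
∖⁺ G F {i} {j} g ¬f with adj F i j
... | true  = contradiction tt ¬f
... | false = Equivalence.from T-∧ (g , tt)

∖⁻ : (G F : Graph n) {i j : Fin n} → _~_ (G ∖ F) i j → _~_ G i j × ¬ _~_ F i j
∖⁻ G F {i} {j} p = let g , f = Equivalence.to T-∧ p in g , T-not⁻ (adj F i j) f

∂⁺ : (G : Graph n) (C : Fin n → Bool) {i j : Fin n} → _~_ G i j → T (C i) → ¬ T (C j) → _~_ (∂ G C) i j
∂⁺ G C {i} {j} g ci ¬cj with C i | C j
... | true | false = Equivalence.from T-∧ (g , tt)
... | true | true  = contradiction tt ¬cj

∂⁻ : (G : Graph n) (C : Fin n → Bool) {i j : Fin n} → _~_ (∂ G C) i j →
     (T (C i) × ¬ T (C j)) ⊎ (T (C j) × ¬ T (C i))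
∂⁻ G C {i} {j} p with C i | C j | proj₂ (Equivalence.to (T-∧ {adj G i j}) p)
... | true  | false | _ = inj₁ (tt , λ ())
... | false | true  | _ = inj₂ (tt , λ ())
... | true  | true  | ()
... | false | false | ()

∂⊆ : (G : Graph n) (C : Fin n → Bool) → ∂ G C ⊆ G
∂⊆ G C {i} {j} p = proj₁ (Equivalence.to (T-∧ {adj G i j}) p)

-- By symmetry it suffices to look at edges oriented out of `C`. With `size-mono` this bounds the
-- size of `F` from below.
∂-least : (G F : Graph n) (C : Fin n → Bool) →
          (∀ {i j} → _~_ G i j → T (C i) → ¬ T (C j) → _~_ F i j) → ∂ G C ⊆ F
∂-least G F C h {i} {j} p with ∂⁻ G C {i} {j} p
... | inj₁ (ci , ¬cj) = h (∂⊆ G C {i} {j} p) ci ¬cj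
... | inj₂ (cj , ¬ci) = symmetric F {j} {i} (h (symmetric G {i} {j} (∂⊆ G C {i} {j} p)) cj ¬ci)

∖∂-closed : (G : Graph n) (C : Fin n → Bool) {i j : Fin n} → T (C i) → _~_ (G ∖ ∂ G C) i j → T (C j)
∖∂-closed G C {i} {j} ci p with ∖⁻ G (∂ G C) {i} {j} p
... | g , ¬∂ = decidable-stable (T? (C j)) λ ¬cj → ¬∂ (∂⁺ G C {i} {j} g ci ¬cj)

∖∂-disconnected : (G : Graph n) (C : Fin n → Bool) {u v : Fin n} → T (C u) → ¬ T (C v) →
                  ¬ Reachable (G ∖ ∂ G C) u v
∖∂-disconnected G C cu ¬cv r = ¬cv (reachable-preserves (G ∖ ∂ G C) (T ∘ C) (∖∂-closed G C) r cu)

∖∂-within : (G : Graph n) (C : Fin n → Bool) {i j : Fin n} → _~_ G i j → T (C i) → T (C j) → _~_ (G ∖ ∂ G C) i j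
∖∂-within G C {i} {j} g ci cj = ∖⁺ G (∂ G C) {i} {j} g λ p → case-⊥ (∂⁻ G C {i} {j} p)
  where
  case-⊥ : (T (C i) × ¬ T (C j)) ⊎ (T (C j) × ¬ T (C i)) → ⊥
  case-⊥ (inj₁ (_ , ¬cj)) = ¬cj cj
  case-⊥ (inj₂ (_ , ¬ci)) = ¬ci ci

∖∂-without : (G : Graph n) (C : Fin n → Bool) {i j : Fin n} → _~_ G i j → ¬ T (C i) → ¬ T (C j) → _~_ (G ∖ ∂ G C) i j
∖∂-without G C {i} {j} g ¬ci ¬cj = ∖⁺ G (∂ G C) {i} {j} g λ p → case-⊥ (∂⁻ G C {i} {j} p)
  where
  case-⊥ : (T (C i) × ¬ T (C j)) ⊎ (T (C j) × ¬ T (C i)) → ⊥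
  case-⊥ (inj₁ (ci , _)) = ¬ci ci
  case-⊥ (inj₂ (cj , _)) = ¬cj cj

∈⇒⟦⟧ : {xs : List (Fin n)} {i : Fin n} → i Mem.∈ xs → T (⟦ xs ⟧ i)
∈⇒⟦⟧ {xs = xs} {i} p = does⁺ (i ∈? xs) p

⟦⟧⇒∈ : {xs : List (Fin n)} {i : Fin n} → T (⟦ xs ⟧ i) → i Mem.∈ xs
⟦⟧⇒∈ {xs = xs} {i} p = does⁻ (i ∈? xs) p

-- Components

component : Graph n → Fin n → Subset n
component G v = tabulate λ u → does (reachable? G v u)

∈-component⁺ : (G : Graph n) {v u : Fin n} → Reachable G v u → u ∈ component G v
∈-component⁺ G {v} {u} r = T⇒∈ (subst T (sym (lookup∘tabulate _ u)) (does⁺ (reachable? G v u) r))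

∈-component⁻ : (G : Graph n) {v u : Fin n} → u ∈ component G v → Reachable G v u
∈-component⁻ G {v} {u} p = does⁻ (reachable? G v u) (subst T (lookup∘tabulate _ u) (∈⇒T p))

isComponent : (G : Graph n) (v : Fin n) → IsComponent G (component G v)
isComponent G v = v , λ u → mk⇔ (∈-component⁻ G) (∈-component⁺ G)

isComponent-resp : (G H : Graph n) → G ⊆ H → H ⊆ G → ∀ {C} → IsComponent G C → IsComponent H C
isComponent-resp G H G⊆H H⊆G (v , h) = v , λ u →
  mk⇔ (reachable-mono G H G⊆H ∘ Equivalence.to (h u)) (Equivalence.from (h u) ∘ reachable-mono H G H⊆G)

another : {C : Subset n} → 1 < ∣ C ∣ → ∀ v → ∃[ u ] u ≢ v × u ∈ C
another {n} {C} 1<C v with any? (λ u → ¬? (u ≟ v) ×-dec T? (lookup C u))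
... | yes (u , u≢v , t) = u , u≢v , T⇒∈ t
... | no  none = contradiction
  (subst (_≤ 1) (sym ∣ C ∣-∑) (count-≤ (lookup C) {v ∷ []} unique₁ λ u t →
    here (decidable-stable (u ≟ v) λ u≢v → none (u , u≢v , t))))
  (<⇒≱ 1<C)

component-neighbour : (G : Graph n) {C : Subset n} (p : IsComponent G C) → 1 < ∣ C ∣ →
                      ∃[ w ] _~_ G (proj₁ p) w
component-neighbour G (v , h) 1<C with another 1<C v
... | u , u≢v , u∈C = first-step G (u≢v ∘ sym) (Equivalence.to (h u) u∈C)

extra-neighbour : (G F : Graph n) → IsExtraEdgeCut 1 G F → ∀ v → ∃[ w ] _~_ (G ∖ F) v w
extra-neighbour G F (_ , _ , big) v =
  component-neighbour (G ∖ F) (isComponent (G ∖ F) v) (big _ (isComponent (G ∖ F) v))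

-- For `h = 1` the size condition only forbids isolated vertices: a vertex and one neighbour already
-- make two.
extra₁ : (G F : Graph n) → F ⊆ G → ¬ Connected (G ∖ F) → (∀ v → ∃[ w ] _~_ (G ∖ F) v w) →
         IsExtraEdgeCut 1 G F
extra₁ G F F⊆G ¬c nb = (λ {i} {j} → F⊆G {i} {j}) , ¬c , big
  where
  big : ∀ C → IsComponent (G ∖ F) C → 1 < ∣ C ∣
  big C (v , h) with nb v
  ... | w , e = ∣∣-≥ (unique₂ (~⇒≢ (G ∖ F) e))
    (Equivalence.from (h v) ε ∷ Equivalence.from (h w) (e ◅ ε) ∷ [])

-- If every component had at least three vertices, `F` would be a 2-extra edge-cut.
small-component : (G F : Graph n) → Connected G → ¬ λ-Connected 2 G → IsExtraEdgeCut 1 G F →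
                  ∃[ C ] IsComponent (G ∖ F) C × ∣ C ∣ ≡ 2
small-component G F c ¬λ₂ (F⊆G , ¬c , big)
  with any? (λ v → ∣ component (G ∖ F) v ∣ ≤? 2)
... | yes (v , le) = component (G ∖ F) v , isComponent (G ∖ F) v ,
                     ≤-antisym le (big _ (isComponent (G ∖ F) v))
... | no  none = contradiction (c , F , (λ {i} {j} → F⊆G {i} {j}) , ¬c , big₂) ¬λ₂
  where
  big₂ : ∀ C → IsComponent (G ∖ F) C → 2 < ∣ C ∣
  big₂ C (v , h) = <-≤-trans (≰⇒> λ le → none (v , le))
    (p⊆q⇒∣p∣≤∣q∣ λ {u} u∈ → Equivalence.from (h u) (∈-component⁻ (G ∖ F) u∈))

-- The boundary of a two-vertex component {x , y} is contained in F.
extra-cut-size : (G F : Graph n) → Connected G → ¬ λ-Connected 2 G → IsExtraEdgeCut 1 G F →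
                 ∃[ x ] ∃[ y ] _~_ G x y × edgeDegree G x y ≤ size F
extra-cut-size G F c ¬λ₂ cut with small-component G F c ¬λ₂ cut
... | C , p@(x , h) , ∣C∣≡2 with component-neighbour (G ∖ F) p (≤-reflexive (sym ∣C∣≡2))
... | y , e = x , y , g , subst (_≤ size F) (size-edge G g)
                (size-mono (∂ G ⟦ x ∷ y ∷ [] ⟧) F (∂-least G F _ in-F))
  where
  g : _~_ G x y
  g = proj₁ (∖⁻ G F {x} {y} e)
  only : ∀ {z} → z ∈ C → z Mem.∈ x ∷ y ∷ []
  only {z} z∈C = decidable-stable (z ∈? (x ∷ y ∷ [])) λ z∉ → <⇒≱
    (∣∣-≥ (unique₃ (λ eq → z∉ (here eq)) (λ eq → z∉ (there (here eq))) (~⇒≢ G g))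
      (z∈C ∷ Equivalence.from (h x) ε ∷ Equivalence.from (h y) (e ◅ ε) ∷ []))
    (≤-reflexive ∣C∣≡2)
  reach : ∀ {i} → i Mem.∈ x ∷ y ∷ [] → Reachable (G ∖ F) x i
  reach (here refl)         = ε
  reach (there (here refl)) = e ◅ ε
  -- An edge at `x` or `y` that avoids `F` stays in the component `C`, whose only members are `x`
  -- and `y`.
  in-F : ∀ {i j} → _~_ G i j → T (⟦ x ∷ y ∷ [] ⟧ i) → ¬ T (⟦ x ∷ y ∷ [] ⟧ j) → _~_ F i j
  in-F {i} {j} gij ti ¬tj = decidable-stable (T? (adj F i j)) λ ¬f → ¬tj (∈⇒⟦⟧ (only
    (Equivalence.from (h j) (reach (⟦⟧⇒∈ ti) ◅◅ (∖⁺ G F {i} {j} gij ¬f ◅ ε)))))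

-- A 2-extra edge-cut of G - F, enlarged by the edges of `G` in `F`, is one of `G`. It is written as
-- `E`, the edges of `G` missing from the final remainder `K`; then `G ∖ E` and `K` have the same
-- edges and hence the same components.
¬λ₂-subgraph : (G F : Graph n) → ¬ λ-Connected 2 G → Connected G → ¬ λ-Connected 2 (G ∖ F)
¬λ₂-subgraph G F ¬λ₂ c (_ , F′ , F′⊆ , ¬c , big) = ¬λ₂ (c , E , (λ {i} {j} p → proj₁ (∖⁻ G K {i} {j} p)) ,
  (λ c′ → ¬c λ u v → reachable-mono (G ∖ E) K E⇒K (c′ u v)) ,
  λ C p → big C (isComponent-resp (G ∖ E) K E⇒K K⇒E p))
  where
  K E : Graph _
  K = G ∖ F ∖ F′
  E = G ∖ K
  E⇒K : G ∖ E ⊆ K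
  E⇒K {i} {j} p with ∖⁻ G E {i} {j} p
  ... | g , ¬e = decidable-stable (T? (adj K i j)) λ ¬k → ¬e (∖⁺ G K {i} {j} g ¬k)
  K⇒E : K ⊆ G ∖ E
  K⇒E {i} {j} k = ∖⁺ G E {i} {j} (proj₁ (∖⁻ G F {i} {j} (proj₁ (∖⁻ (G ∖ F) F′ {i} {j} k))))
    λ e → proj₂ (∖⁻ G K {i} {j} e) k

-- Super-λ′ graphs

least : {P : ℕ → Set} → Decidable P → ∀ {m} → P m → ∃[ k ] IsMinimum P k
least {P} P? {m} pm with below (suc m)
  where
  below : ∀ m → (∀ j → j < m → ¬ P j) ⊎ (∃[ k ] IsMinimum P k)
  below zero = inj₁ λ _ ()
  below (suc m) with below m | P? m
  ... | inj₂ r    | _      = inj₂ r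
  ... | inj₁ none | yes pm = inj₂ (m , pm , λ j pj → ≮⇒≥ λ j<m → none j j<m pj)
  ... | inj₁ none | no ¬pm = inj₁ λ j j<1+m pj → ¬pm
    (subst P (≤-antisym (≤-pred j<1+m) (≮⇒≥ λ j<m → none j j<m pj)) pj)
... | inj₁ none = contradiction pm (none m ≤-refl)
... | inj₂ r    = r

minDegree : (G : Graph n) → Fin n → ∃[ δ ] IsMinDegree G δ
minDegree G v = least (λ d → any? λ v → degree G v ≟ℕ d) (v , refl)

minEdgeDegree : (G : Graph n) {x y : Fin n} → _~_ G x y → ∃[ ξ ] IsMinEdgeDegree G ξ
minEdgeDegree G {x} {y} e =
  least (λ d → any? λ x → any? λ y → T? (adj G x y) ×-dec (edgeDegree G x y ≟ℕ d)) (x , y , e , refl)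

degree-≥ : (G : Graph n) {v : Fin n} {xs : List (Fin n)} → Unique xs → All (_~_ G v) xs → length xs ≤ degree G v
degree-≥ G {v} u a = ≤-trans (count-≥ (adj G v) u a) (≤-reflexive (sym (degree-∑ G v)))

degree-≤ : (G : Graph n) {v : Fin n} {xs : List (Fin n)} → Unique xs → (∀ j → _~_ G v j → j Mem.∈ xs) →
           degree G v ≤ length xs
degree-≤ G {v} u h = ≤-trans (≤-reflexive (degree-∑ G v)) (count-≤ (adj G v) u h)

edgeDegree-comm : (G : Graph n) (x y : Fin n) → edgeDegree G x y ≡ edgeDegree G y x
edgeDegree-comm G x y = cong (_∸ 2) (+-comm (degree G x) (degree G y))

-- Only the right-hand difference has to be exact, which `1 ≤ a` and `1 ≤ c` ensure; truncation on
-- the left does no harm.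
∸2-cancel : ∀ a {b c} → 1 ≤ a → 1 ≤ c → a + b ∸ 2 ≤ a + c ∸ 2 → b ≤ c
∸2-cancel a {b} {c} 1≤a 1≤c le = +-cancelˡ-≤ a b c
  (≤-trans (m≤n+m∸n (a + b) 2) (≤-trans (+-monoʳ-≤ 2 le) (≤-reflexive (m+[n∸m]≡n (+-mono-≤ 1≤a 1≤c)))))

-- A connected graph with a vertex fails this exactly when it is a star; the form supplies an edge
-- that survives the removal of `x`.
NonStar : Graph n → Set
NonStar G = ∀ x → ∃[ a ] ∃[ b ] _~_ G a b × a ≢ x × b ≢ x

-- Boundaries of edges of minimum edge-degree.

module _ {n : ℕ} (G : Graph n) (conn : Connected G) (4≤n : 4 ≤ n) (nonStar : NonStar G)
         (¬λ₂ : ¬ λ-Connected 2 G) where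

  private
    neighbour : ∀ u → ∃[ w ] _~_ G u w
    neighbour = connected-neighbour G conn (≤-trans (s≤s (s≤s z≤n)) 4≤n)

    ~-symm : ∀ {i j} → _~_ G i j → _~_ G j i
    ~-symm {i} {j} = symmetric G {i} {j}

  MinimalEdge : Fin n → Fin n → Set
  MinimalEdge x y = ∀ {a b} → _~_ G a b → edgeDegree G x y ≤ edgeDegree G a b

  -- The edges `xy` and `xw` share `x`, so its degree cancels when their edge-degrees are compared.
  degree-≤-across : ∀ {x y w} → MinimalEdge x y → _~_ G x y → _~_ G x w → degree G y ≤ degree G w
  degree-≤-across {x} {y} {w} min xy xw =
    ∸2-cancel (degree G x) (degree-≥ G unique₁ (xy ∷ [])) (degree-≥ G unique₁ (~-symm xw ∷ [])) (min xw)

  -- Comparing `xy` with `xw` and with `yw` gives `y` and `x` degree at most 2 as well. The triangle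
  -- is then closed under adjacency, against connectedness on at least four vertices.
  ¬triangle : ∀ {x y w} → MinimalEdge x y → _~_ G x y → _~_ G w x → _~_ G w y → degree G w ≤ 2 → ⊥
  ¬triangle {x} {y} {w} min xy wx wy dw = z∉ (reachable-preserves G (Mem._∈ T₃) closed (conn x z) (here refl))
    where
    T₃ = x ∷ y ∷ w ∷ []
    x≢y = ~⇒≢ G xy
    w≢x = ~⇒≢ G wx
    w≢y = ~⇒≢ G wy
    new : ∃[ z ] ¬ z Mem.∈ T₃
    new = fresh (unique₃ x≢y (w≢x ∘ sym) (w≢y ∘ sym)) 4≤n
    z = proj₁ new
    z∉ = proj₂ new
    dy : degree G y ≤ 2
    dy = ≤-trans (degree-≤-across min xy (~-symm wx)) dw
    dx : degree G x ≤ 2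
    dx = ≤-trans (degree-≤-across
      (λ e → ≤-trans (≤-reflexive (edgeDegree-comm G y x)) (min e)) (~-symm xy) (~-symm wy)) dw
    third : ∀ {v a b j} → degree G v ≤ 2 → _~_ G v a → _~_ G v b → a ≢ b → _~_ G v j → j Mem.∈ a ∷ b ∷ []
    third {v} {a} {b} {j} d va vb a≢b vj = decidable-stable (j ∈? (a ∷ b ∷ [])) λ j∉ → <⇒≱
      (degree-≥ G (unique₃ (λ e → j∉ (here e)) (λ e → j∉ (there (here e))) a≢b) (vj ∷ va ∷ vb ∷ [])) d
    closed : ∀ {i j} → i Mem.∈ T₃ → _~_ G i j → j Mem.∈ T₃
    closed (here refl) e = there (third dx xy (~-symm wx) (w≢y ∘ sym) e)
    closed (there (here refl)) e with third dy (~-symm xy) (~-symm wy) (w≢x ∘ sym) e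
    ... | here p         = here p
    ... | there (here p) = there (there (here p))
    closed (there (there (here refl))) e with third dw wx wy x≢y e
    ... | here p         = here p
    ... | there (here p) = there (here p)

  -- If y and w are pendant at x, then the component of G - x containing an
  -- edge ab is cut off by at most d(x) - 2 edges, fewer than the d(x) - 1
  -- edges adjacent to xy.
  ¬two-pendants : ∀ {x y w} → MinimalEdge x y → y ≢ w → _~_ G x y → _~_ G x w →
                  (∀ j → _~_ G y j → j ≡ x) → (∀ j → _~_ G w j → j ≡ x) → ⊥
  ¬two-pendants {x} {y} {w} min y≢w xy xw only-y only-w with nonStar x
  ... | a , b , ab , a≢x , b≢x = absurd (extra-cut-size G (∂ G D) conn ¬λ₂ cut)
    where
    -- `K` isolates `x` instead of removing it and so stands for G - x; `C` is the component of `a`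
    -- there and `D` the rest, with `x`, `y` and `w` in it.
    K : Graph n
    K = G ∖ ∂ G ⟦ x ∷ [] ⟧
    C D : Fin n → Bool
    C u = does (reachable? K a u)
    D u = not (C u)
    D⁺ : ∀ {u} → ¬ T (C u) → T (D u)
    D⁺ {u} h with C u
    ... | true  = h tt
    ... | false = tt
    D⁻ : ∀ {u} → ¬ T (D u) → T (C u)
    D⁻ {u} h with C u
    ... | true  = tt
    ... | false = h tt
    ¬D : ∀ {u} → T (C u) → ¬ T (D u)
    ¬D {u} c d with C u
    ¬D () d | false
    reach : ∀ {u} → T (C u) → Reachable K a u
    reach {u} = does⁻ (reachable? K a u)
    extend : ∀ {u v} → T (C u) → _~_ K u v → T (C v)
    extend {u} {v} c e = does⁺ (reachable? K a v) (reach c ◅◅ (e ◅ ε))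
    Ca : T (C a)
    Ca = does⁺ (reachable? K a a) ε
    ∉x : ∀ {v} → v ≢ x → ¬ T (⟦ x ∷ [] ⟧ v)
    ∉x v≢x t with ⟦⟧⇒∈ {xs = x ∷ []} t
    ... | here e = v≢x e
    K-edge : ∀ {u v} → _~_ G u v → u ≢ x → v ≢ x → _~_ K u v
    K-edge {u} {v} e u≢x v≢x = ∖∂-without G ⟦ x ∷ [] ⟧ {u} {v} e (∉x u≢x) (∉x v≢x)
    C-≢x : ∀ {u} → T (C u) → u ≢ x
    C-≢x c refl = ∖∂-disconnected G ⟦ x ∷ [] ⟧ (∈⇒⟦⟧ {xs = x ∷ []} (here refl)) (∉x a≢x)
      (reachable-sym K (reach c))
    C-neighbour : ∀ v → T (C v) → ∃[ m ] _~_ K v m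
    C-neighbour v c with v ≟ a
    -- The edge `ab` avoids `x`, so `a` is not isolated in `K`.
    ... | yes refl = b , K-edge ab a≢x b≢x
    ... | no  v≢a  = first-step K v≢a (reachable-sym K (reach c))
    pendant : ∀ {v} → (∀ j → _~_ G v j → j ≡ x) → T (D v)
    -- A vertex of `C` has a neighbour in `C`, hence one other than `x`.
    pendant {v} only = D⁺ λ c → let m , e = C-neighbour v c in
      C-≢x (extend c e) (only m (proj₁ (∖⁻ G (∂ G ⟦ x ∷ [] ⟧) {v} {m} e)))
    Dx : T (D x)
    Dx = D⁺ λ c → C-≢x c refl
    crossing : ∀ {i j} → _~_ G i j → T (D i) → ¬ T (D j) → i ≡ x
    -- Otherwise the edge survives in `K` and draws `i` into `C`.
    crossing {i} {j} e d ¬d = decidable-stable (i ≟ x) λ i≢x →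
      ¬D (extend (D⁻ ¬d) (K-edge (~-symm e) (C-≢x (D⁻ ¬d)) i≢x)) d
    cut : IsExtraEdgeCut 1 G (∂ G D)
    cut = extra₁ G (∂ G D) (λ {i} {j} → ∂⊆ G D {i} {j})
      (λ c → ∖∂-disconnected G D Dx (¬D Ca) (c x a)) neighbours
      where
      neighbours : ∀ v → ∃[ m ] _~_ (G ∖ ∂ G D) v m
      neighbours v with T? (D v)
      ... | no ¬d = let m , e = C-neighbour v (D⁻ ¬d) in m ,
        ∖∂-without G D {v} {m} (proj₁ (∖⁻ G (∂ G ⟦ x ∷ [] ⟧) {v} {m} e)) ¬d (¬D (extend (D⁻ ¬d) e))
      ... | yes d with neighbour v
      ... | m , e with T? (D m)
      ... | yes dm = m , ∖∂-within G D {v} {m} e d dm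
      -- The neighbour found lies in `C`, so the vertex is `x`; its pendant neighbour `y` serves
      -- instead.
      ... | no ¬dm rewrite crossing e d ¬dm = y , ∖∂-within G D {x} {y} xy Dx (pendant only-y)
    -- The neighbours `y` and `w` of `x` lie inside `D` and account for the 2.
    2+out≤degree : 2 + out G D x ≤ degree G x
    2+out≤degree = ≤-trans (+-monoʳ-≤ 2 (∑-mono below)) (≤-reflexive (sym (begin
      degree G x                                                ≡⟨ degree-∑ G x ⟩
      ∑[ j < n ] 𝟙 (adj G x j)                                  ≡⟨ ∑-split (𝟙 ∘ adj G x) (unique₂ y≢w) ⟩
      𝟙 (adj G x y) + (𝟙 (adj G x w) + 0) + r                   ≡⟨ cong₂ (λ p q → p + (q + 0) + r) (𝟙-true xy) (𝟙-true xw) ⟩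
      2 + r                                                     ∎)))
      where
      open ≡-Reasoning
      r = ∑[ j < n ] off (y ∷ w ∷ []) (𝟙 ∘ adj G x) j
      below : ∀ j → 𝟙 (D x ∧ not (D j) ∧ adj G x j) ≤ off (y ∷ w ∷ []) (𝟙 ∘ adj G x) j
      below j = off-elim (y ∷ w ∷ []) (𝟙 ∘ adj G x) (λ k → 𝟙 (D x ∧ not (D j) ∧ adj G x j) ≤ k) j
        (λ j∈ → ≤-reflexive (𝟙-false λ t → T-not⁻ (D j) (proj₁ (rest t)) (D-pendant j∈)))
        (λ _ → 𝟙-≤ (proj₂ ∘ rest))
        where
        rest : T (D x ∧ not (D j) ∧ adj G x j) → T (not (D j)) × T (adj G x j)
        rest t = Equivalence.to (T-∧ {not (D j)}) (proj₂ (Equivalence.to (T-∧ {D x}) t))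
        D-pendant : ∀ {j} → j Mem.∈ y ∷ w ∷ [] → T (D j)
        D-pendant (here refl)         = pendant only-y
        D-pendant (there (here refl)) = pendant only-w
    size≡out : size (∂ G D) ≡ out G D x
    size≡out = trans (size-∂ G D) (trans (∑-support (out G D) unique₁ vanish) (+-identityʳ _))
      where
      vanish : ∀ i → ¬ i Mem.∈ x ∷ [] → out G D i ≡ 0
      vanish i i∉ = ∑-zero λ j → 𝟙-false λ t →
        let d , t′ = Equivalence.to (T-∧ {D i}) t
            nd , e = Equivalence.to (T-∧ {not (D j)}) t′
        in i∉ (here (crossing e d (T-not⁻ (D j) nd)))
    absurd : ∃[ p ] ∃[ q ] _~_ G p q × edgeDegree G p q ≤ size (∂ G D) → ⊥
    -- Minimality, d(y) ≥ 1 and the bound on the cut give d(x) ≤ 1 + |∂D|, whereas the two pendants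
    -- give |∂D| ≤ d(x) - 2.
    absurd (p , q , pq , le) = <-irrefl refl (begin-strict
      degree G x                          ≡⟨ m+n∸n≡m (degree G x) 1 ⟨
      degree G x + 1 ∸ 1                  ≤⟨ ∸-monoˡ-≤ 1 (+-monoʳ-≤ (degree G x) (degree-≥ G unique₁ (~-symm xy ∷ []))) ⟩
      degree G x + degree G y ∸ 1         ≤⟨ m≤n+m∸n _ 1 ⟩
      1 + (degree G x + degree G y ∸ 1 ∸ 1) ≡⟨ cong suc (∸-+-assoc (degree G x + degree G y) 1 1) ⟩
      1 + edgeDegree G x y                ≤⟨ s≤s (≤-trans (min pq) le) ⟩
      1 + size (∂ G D)                    ≡⟨ cong suc size≡out ⟩
      1 + out G D x                       <⟨ 2+out≤degree ⟩
      degree G x                          ∎)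
      where open ≤-Reasoning

  -- If `w` is also adjacent to `y`, there is a triangle with d(w) ≤ 2. Otherwise `w` is pendant at
  -- `x`, and comparing `xy` with `xw` makes `y` pendant too.
  ¬isolated : ∀ {x y w} → MinimalEdge x y → _~_ G x y → w ≢ y → (∀ j → _~_ G w j → j Mem.∈ x ∷ y ∷ []) →
              _~_ G w x → ⊥
  ¬isolated {x} {y} {w} min xy w≢y inside wx with T? (adj G w y)
  ... | yes wy = ¬triangle min xy wx wy (degree-≤ G (unique₂ (~⇒≢ G xy)) inside)
  ... | no ¬wy = ¬two-pendants min (w≢y ∘ sym) xy (~-symm wx) only-y only-w
    where
    only-w : ∀ j → _~_ G w j → j ≡ x
    only-w j e with inside j e
    ... | here p            = p
    ... | there (here refl) = contradiction e ¬wy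
    only-y : ∀ j → _~_ G y j → j ≡ x
    only-y j e = decidable-stable (j ≟ x) λ j≢x → <⇒≱
      (degree-≥ G (unique₂ j≢x) (e ∷ ~-symm xy ∷ []))
      (≤-trans (degree-≤-across min xy (~-symm wx)) (degree-≤ G unique₁ λ j e → here (only-w j e)))

  -- Each end of the edge keeps the other. An outside vertex that loses all its neighbours has them
  -- all in `{x , y}`, which `¬isolated` excludes, with `x` and `y` exchanged if need be.
  minimal-edge-cut : ∀ {x y} → MinimalEdge x y → _~_ G x y → IsExtraEdgeCut 1 G (∂ G ⟦ x ∷ y ∷ [] ⟧)
  minimal-edge-cut {x} {y} min xy = extra₁ G (∂ G E) (λ {i} {j} → ∂⊆ G E {i} {j})
    (λ c → let z , z∉ = fresh (unique₂ (~⇒≢ G xy)) (≤-trans (s≤s (s≤s (s≤s z≤n))) 4≤n) in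
      ∖∂-disconnected G E Ex (z∉ ∘ ⟦⟧⇒∈) (c x z))
    neighbours
    where
    E : Fin n → Bool
    E = ⟦ x ∷ y ∷ [] ⟧
    Ex : T (E x)
    Ex = ∈⇒⟦⟧ {xs = x ∷ y ∷ []} (here refl)
    Ey : T (E y)
    Ey = ∈⇒⟦⟧ {xs = x ∷ y ∷ []} (there (here refl))
    neighbours : ∀ v → ∃[ m ] _~_ (G ∖ ∂ G E) v m
    neighbours v with v ∈? (x ∷ y ∷ [])
    ... | yes (here refl)         = y , ∖∂-within G E {x} {y} xy Ex Ey
    ... | yes (there (here refl)) = x , ∖∂-within G E {y} {x} (~-symm xy) Ey Ex
    ... | no v∉ with any? (λ m → T? (adj G v m) ×-dec ¬? (m ∈? (x ∷ y ∷ [])))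
    ... | yes (m , e , m∉) = m , ∖∂-without G E {v} {m} e (v∉ ∘ ⟦⟧⇒∈) (m∉ ∘ ⟦⟧⇒∈)
    ... | no  none with neighbour v
    ... | m , e = contradiction (inside m e) λ where
        (here refl)         → ¬isolated min xy (λ p → v∉ (there (here p))) inside e
        (there (here refl)) → ¬isolated (λ e → ≤-trans (≤-reflexive (edgeDegree-comm G y x)) (min e))
          (~-symm xy) (λ p → v∉ (here p)) (λ j e → swap (inside j e)) e
      where
      inside : ∀ j → _~_ G v j → j Mem.∈ x ∷ y ∷ []
      inside j e = decidable-stable (j ∈? (x ∷ y ∷ [])) λ j∉ → none (j , e , j∉)
      swap : ∀ {j} → j Mem.∈ x ∷ y ∷ [] → j Mem.∈ y ∷ x ∷ []
      swap (here p)         = there (here p)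
      swap (there (here p)) = here p

  -- The boundary of `xy` attains the edge-degree, and `extra-cut-size` shows that no cut is
  -- smaller. A two-vertex component exists for every 1-extra edge-cut, minimum or not.
  super-at : ∀ {x y} → _~_ G x y → MinimalEdge x y → Super-λ′ G
  super-at {x} {y} xy minimal =
    (conn , ∂ G ⟦ x ∷ y ∷ [] ⟧ , cut) ,
    (edgeDegree G x y , (conn , (∂ G ⟦ x ∷ y ∷ [] ⟧ , cut , size-edge G xy) , lower) ,
      (x , y , xy , refl) , λ { _ (a , b , ab , refl) → minimal ab }) ,
    λ F c → small-component G F conn ¬λ₂ (proj₁ c)
    where
    cut : IsExtraEdgeCut 1 G (∂ G ⟦ x ∷ y ∷ [] ⟧)
    cut = minimal-edge-cut minimal xy
    lower : ∀ j → (∃[ F ] IsExtraEdgeCut 1 G F × size F ≡ j) → edgeDegree G x y ≤ j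
    lower j (F , cutF , refl) =
      let _ , _ , ab , le = extra-cut-size G F conn ¬λ₂ cutF in ≤-trans (minimal ab) le

  super : ∃[ ξ ] IsMinEdgeDegree G ξ → Super-λ′ G
  super (ξ , (x , y , xy , refl) , min) = super-at xy λ {a} {b} ab → min _ (a , b , ab , refl)

-- Two components of G - F contain edges, and `x` lies in at most one of them; the edge in the other
-- avoids `x`.
extra-cut⇒nonStar : (G F : Graph n) → IsExtraEdgeCut 1 G F → NonStar G
extra-cut⇒nonStar G F cut@(_ , ¬c , _) x with disconnected (G ∖ F) ¬c
... | u , v , ¬r with extra-neighbour G F cut u | extra-neighbour G F cut v | reachable? (G ∖ F) u x
... | u′ , e | v′ , e′ | yes ux = v , v′ , proj₁ (∖⁻ G F {v} {v′} e′) ,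
  (λ { refl → ¬r ux }) , λ { refl → ¬r (ux ◅◅ reachable-sym (G ∖ F) (e′ ◅ ε)) }
... | u′ , e | v′ , e′ | no ¬ux = u , u′ , proj₁ (∖⁻ G F {u} {u′} e) ,
  (λ { refl → ¬ux ε }) , λ { refl → ¬ux (e ◅ ε) }

-- Two edges of G - F in different components have four distinct ends.
extra-cut⇒4≤n : (G F : Graph n) → IsExtraEdgeCut 1 G F → 4 ≤ n
extra-cut⇒4≤n {n} G F cut@(_ , ¬c , _) with disconnected (G ∖ F) ¬c
... | u , v , ¬r with extra-neighbour G F cut u | extra-neighbour G F cut v
... | u′ , e | v′ , e′ = subst (4 ≤_) (∑-one n) (count-≥ (λ _ → true)
  ((~⇒≢ (G ∖ F) e ∷ (λ { refl → ¬r ε }) ∷ (λ { refl → ¬r vv′ }) ∷ []) ∷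
    unique₃ (λ { refl → ¬r (e ◅ ε) }) (λ { refl → ¬r (e ◅ vv′) }) (~⇒≢ (G ∖ F) e′))
  (tt ∷ tt ∷ tt ∷ tt ∷ []))
  where
  vv′ : Reachable (G ∖ F) v′ v
  vv′ = reachable-sym (G ∖ F) (e′ ◅ ε)

empty : (F : EdgeSet n) → size F ≤ 0 → ∀ {i j} → ¬ _~_ F i j
empty F s≤0 {i} e = <⇒≱ (degree-≥ F unique₁ (e ∷ [])) (begin
  degree F i               ≡⟨ +-identityʳ _ ⟨
  degree F i + 0           ≤⟨ ∑-≥ (degree F) unique₁ ⟩
  ∑[ j < _ ] degree F j    ≡⟨ handshake F ⟩
  size F + size F          ≤⟨ +-mono-≤ s≤0 s≤0 ⟩
  0                        ∎)
  where open ≤-Reasoning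

-- Removal of fewer edges than the minimum degree.

module _ {n : ℕ} (G : Graph n) (conn : Connected G) (4≤n : 4 ≤ n) (¬λ₂ : ¬ λ-Connected 2 G)
         (F : EdgeSet n) (F⊆G : F ⊆ G) (few : ∀ v → size F < degree G v) where

  -- Isolating `v` takes all of its edges, more than `F` has.
  ∖-neighbour : ∀ v → ∃[ w ] _~_ (G ∖ F) v w
  ∖-neighbour v with any? (λ w → T? (adj (G ∖ F) v w))
  ... | yes r    = r
  ... | no  none = contradiction
    (subst (_≤ size F) (size-star G v) (size-mono (∂ G ⟦ v ∷ [] ⟧) F (∂-least G F _ in-F)))
    (<⇒≱ (few v))
    where
    in-F : ∀ {i j} → _~_ G i j → T (⟦ v ∷ [] ⟧ i) → ¬ T (⟦ v ∷ [] ⟧ j) → _~_ F i j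
    in-F {i} {j} e t _ with ⟦⟧⇒∈ {xs = v ∷ []} {i} t
    ... | here refl = decidable-stable (T? (adj F i j)) λ ¬f → none (j , ∖⁺ G F {i} {j} e ¬f)

  -- A disconnecting `F` would be a 1-extra edge-cut, at least as large as some edge-degree. This
  -- forces `F` to be empty, so nothing has been removed.
  connected-∖ : Connected (G ∖ F)
  connected-∖ = decidable-stable (connected? (G ∖ F)) λ ¬c →
    let x , y , _ , le = extra-cut-size G F conn ¬λ₂ (extra₁ G F (λ {i} {j} → F⊆G {i} {j}) ¬c ∖-neighbour)
    in ¬c λ u v → reachable-mono G (G ∖ F) (λ {i} {j} e → ∖⁺ G F {i} {j} e (empty F (tiny x y le))) (conn u v)
    where
    tiny : ∀ x y → edgeDegree G x y ≤ size F → size F ≤ 0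
    -- Both ends have degree above |F|, so 2|F| + 2 ≤ d(x) + d(y) ≤ |F| + 2.
    tiny x y le = +-cancelʳ-≤ (2 + size F) (size F) 0 (begin
      size F + (2 + size F)              ≡⟨ +-suc (size F) (1 + size F) ⟩
      suc (size F + suc (size F))        ≤⟨ +-mono-≤ (few x) (few y) ⟩
      degree G x + degree G y            ≤⟨ m≤n+m∸n (degree G x + degree G y) 2 ⟩
      2 + edgeDegree G x y               ≤⟨ +-monoʳ-≤ 2 le ⟩
      2 + size F                         ∎)
      where open ≤-Reasoning

  -- If every edge of G - F contained x, then each vertex v ≠ x would satisfy
  -- d_F(v) ≥ d_G(v) - 1 ≥ |F|; three such vertices contradict the handshake
  -- lemma unless F is empty.
  nonStar-∖ : NonStar G → NonStar (G ∖ F)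
  nonStar-∖ nonStar x
    with any? (λ a → any? λ b → T? (adj (G ∖ F) a b) ×-dec ¬? (a ≟ x) ×-dec ¬? (b ≟ x))
  ... | yes r    = r
  ... | no  none with nonStar x
  ... | a , b , ab , a≢x , b≢x = contradiction (in-F ab a≢x b≢x) (empty F F-empty)
    where
    in-F : ∀ {i j} → _~_ G i j → i ≢ x → j ≢ x → _~_ F i j
    in-F {i} {j} e i≢x j≢x = decidable-stable (T? (adj F i j)) λ ¬f →
      none (i , j , ∖⁺ G F {i} {j} e ¬f , i≢x , j≢x)
    degree-F : ∀ {v} → v ≢ x → size F ≤ degree F v
    degree-F {v} v≢x = ≤-pred (begin
      1 + size F                                                 ≤⟨ few v ⟩
      degree G v                                                 ≡⟨ degree-∑ G v ⟩
      ∑[ j < n ] 𝟙 (adj G v j)                                   ≡⟨ ∑-split (𝟙 ∘ adj G v) {x ∷ []} unique₁ ⟩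
      -- At most one edge joins `v` to `x`, and every other edge at `v` lies in `F`.
      𝟙 (adj G v x) + 0 + ∑[ j < n ] off (x ∷ []) (𝟙 ∘ adj G v) j ≤⟨ +-mono-≤ (+-monoˡ-≤ 0 (𝟙-≤ {b = true} λ _ → tt)) (∑-mono below) ⟩
      1 + ∑[ j < n ] 𝟙 (adj F v j)                               ≡⟨ cong suc (degree-∑ F v) ⟨
      1 + degree F v                                             ∎)
      where
      open ≤-Reasoning
      below : ∀ j → off (x ∷ []) (𝟙 ∘ adj G v) j ≤ 𝟙 (adj F v j)
      below j = off-elim (x ∷ []) (𝟙 ∘ adj G v) (_≤ 𝟙 (adj F v j)) j
        (λ _ → z≤n) (λ j∉ → 𝟙-≤ λ e → in-F e v≢x (λ p → j∉ (here p)))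
    F-empty : size F ≤ 0
    F-empty with fresh {xs = x ∷ []} unique₁ (≤-trans (s≤s (s≤s z≤n)) 4≤n)
    ... | u , u∉ with fresh {xs = u ∷ x ∷ []} (unique₂ (λ p → u∉ (here p))) (≤-trans (s≤s (s≤s (s≤s z≤n))) 4≤n)
    ... | v , v∉ with fresh {xs = v ∷ u ∷ x ∷ []}
                        (unique₃ (λ p → v∉ (here p)) (λ p → v∉ (there (here p))) (λ p → u∉ (here p))) 4≤n
    ... | w , w∉ = +-cancelˡ-≤ (s + s) s 0 (begin
      s + s + s                                             ≡⟨ +-assoc s s s ⟩
      s + (s + s)                                           ≡⟨ cong (λ k → s + (s + k)) (+-identityʳ s) ⟨
      s + (s + (s + 0))                                     ≤⟨ +-mono-≤ (degree-F λ p → w∉ (there (there (here p))))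
                                                                 (+-mono-≤ (degree-F λ p → v∉ (there (here p)))
                                                                   (+-monoˡ-≤ 0 (degree-F λ p → u∉ (here p)))) ⟩
      degree F w + (degree F v + (degree F u + 0))          ≤⟨ ∑-≥ (degree F)
                                                                 (unique₃ (λ p → w∉ (here p)) (λ p → w∉ (there (here p))) (λ p → v∉ (here p))) ⟩
      ∑[ j < n ] degree F j                                 ≡⟨ handshake F ⟩
      s + s                                                 ≡⟨ +-identityʳ (s + s) ⟨
      s + s + 0                                             ∎)
      where
      open ≤-Reasoning
      s = size F

-- The value of the persistence.

theorem2p3 : ∀ {n : ℕ} (G : Graph n) → Super-λ′ G → ¬ λ-Connected 2 G →
    ∃[ δ ] IsMinDegree G δ × IsPersistence G (+ δ - + 1)
theorem2p3 {n} G ((conn , F₀ , cut₀) , _) ¬λ₂ = persistence (disconnected (G ∖ F₀) (proj₁ (proj₂ cut₀)))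
  where
  4≤n : 4 ≤ n
  4≤n = extra-cut⇒4≤n G F₀ cut₀
  persistence : ∃[ u ] ∃[ v ] ¬ Reachable (G ∖ F₀) u v → ∃[ δ ] IsMinDegree G δ × IsPersistence G (+ δ - + 1)
  -- The unreachable pair supplies a vertex, so that a minimum degree exists.
  persistence (u , _) with minDegree G u
  ... | δ , (v , refl) , min = δ , ((v , refl) , min) , stays-super , maximal
    where
    stays-super : ∀ F → F ⊆ G → + size F ℤ.≤ + δ - + 1 → Super-λ′ (G ∖ F)
    stays-super F F⊆G le = super (G ∖ F)
      (connected-∖ G conn 4≤n ¬λ₂ F F⊆G few) 4≤n nonStar (¬λ₂-subgraph G F ¬λ₂ conn)
      -- Any instance of `NonStar` contains an edge, so a minimum edge-degree exists.
      (minEdgeDegree (G ∖ F) (proj₁ (proj₂ (proj₂ (nonStar u)))))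
      where
      few : ∀ w → size F < degree G w
      few w = <-≤-trans
        (ℤ.drop‿+<+ (ℤ.i≤pred[j]⇒i<j (subst (λ m → + size F ℤ.≤ m) (ℤ.+-comm (+ δ) (ℤ.- + 1)) le)))
        (min _ (w , refl))
      nonStar : NonStar (G ∖ F)
      nonStar = nonStar-∖ G conn 4≤n ¬λ₂ F F⊆G few (extra-cut⇒nonStar G F₀ cut₀)
    star : EdgeSet n
    star = ∂ G ⟦ v ∷ [] ⟧
    maximal : ∀ m → (∀ F → F ⊆ G → + size F ℤ.≤ m → Super-λ′ (G ∖ F)) → m ℤ.≤ + δ - + 1
    -- If m ≥ δ, the star at `v` may be deleted; it has δ edges and separates `v` from every other
    -- vertex.
    maximal m h = subst (m ℤ.≤_) (ℤ.+-comm (ℤ.- + 1) (+ δ)) (ℤ.i<j⇒i≤pred[j] (ℤ.≰⇒> λ δ≤m →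
      let (c , _) , _ = h star (λ {i} {j} → ∂⊆ G ⟦ v ∷ [] ⟧ {i} {j})
                          (subst (λ s → + s ℤ.≤ m) (sym (size-star G v)) δ≤m)
          z , z∉ = fresh {xs = v ∷ []} unique₁ (≤-trans (s≤s (s≤s z≤n)) 4≤n)
      in ∖∂-disconnected G ⟦ v ∷ [] ⟧ (∈⇒⟦⟧ {xs = v ∷ []} (here refl)) (z∉ ∘ ⟦⟧⇒∈) (c v z)))
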